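{- For every fixed positive integer $c$, and for every positive integer $k$ large enough compared to $c$, there exists a tournament $T$ on $2k+c$ vertices such that $\mathrm{sinv}'_k(T) > \frac{1}{2}\log(2k+c) - \log(2c)$. In particular, for every fixed positive integer $c$, $m'_k(2k+c)$ is unbounded as $k\to\infty$.
   Context: Logarithms are to base 2. A tournament is an orientation of a complete graph. For a digraph $D$ and $X \subseteq V(D)$, inverting $X$ means reversing the direction of every arc of $D$ with both endvertices in $X$. A digraph $D$ is $k$-arc-strong if for every partition $(V_1,V_2)$ of $V(D)$ into nonempty sets there are at least $k$ arcs from $V_1$ to $V_2$. $\mathrm{sinv}'_k(D)$ is the minimum number of sets whose successive inversion transforms $D$ into a $k$-arc-strong digraph. For $n\ge 2k+1$, $m'_k(n)=\max\{\mathrm{sinv}'_k(T): T \text{ tournament of order } n\}$. -}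

module Defs where

open import Data.Bool using (Bool; false; not; _∧_; if_then_else_)
open import Data.Fin using (Fin)
open import Data.Fin.Subset using (Subset; Nonempty; ∁)
open import Data.List using (List; length; foldl; filterᵇ; allFin; cartesianProduct)
open import Data.Nat using (ℕ; _*_; _^_; _≤_; _<_)
open import Data.Product using (_×_; _,_; Σ-syntax; ∃-syntax)
open import Data.Vec using (lookup)
open import Relation.Binary.PropositionalEquality using (_≡_; _≢_)

IsMinimum : (ℕ → Set) → ℕ → Set
IsMinimum P m = P m × (∀ j → P j → m ≤ j)

IsMaximum : (ℕ → Set) → ℕ → Set
IsMaximum P m = P m × (∀ j → P j → j ≤ m)

-- Adjacency matrices: D u v ≡ true means that u → v is an arc.
Digraph : ℕ → Set
Digraph n = Fin n → Fin n → Bool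

record IsTournament {n : ℕ} (D : Digraph n) : Set where
  field
    loopless : ∀ u → D u u ≡ false
    oriented : ∀ u v → u ≢ v → D u v ≡ not (D v u)

Tournament : ℕ → Set
Tournament n = Σ[ D ∈ Digraph n ] IsTournament D

invert : {n : ℕ} → Digraph n → Subset n → Digraph n
invert D X u v = if lookup X u ∧ lookup X v then D v u else D u v

invertAll : {n : ℕ} → Digraph n → List (Subset n) → Digraph n
invertAll = foldl invert

#arcs : {n : ℕ} → Digraph n → Subset n → Subset n → ℕ
#arcs {n} D V₁ V₂ =
  length (filterᵇ (λ (u , v) → lookup V₁ u ∧ lookup V₂ v ∧ D u v)
                  (cartesianProduct (allFin n) (allFin n)))

ArcStrong : {n : ℕ} → ℕ → Digraph n → Set
ArcStrong {n} k D =
  (V : Subset n) → Nonempty V → Nonempty (∁ V) → k ≤ #arcs D V (∁ V)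

InvertibleIn : {n : ℕ} → ℕ → Digraph n → ℕ → Set
InvertibleIn {n} k D s =
  Σ[ Xs ∈ List (Subset n) ] length Xs ≡ s × ArcStrong k (invertAll D Xs)

-- sinv′ₖ(D) = s.  A relation, since the minimum need not exist for
-- arbitrary D and k.
Sinv′ : {n : ℕ} → ℕ → Digraph n → ℕ → Set
Sinv′ k D = IsMinimum (InvertibleIn k D)

-- m′ₖ(n) = m.
M′ : ℕ → ℕ → ℕ → Set
M′ k n = IsMaximum (λ s → ∃[ D ] IsTournament {n} D × Sinv′ k D s)

-- For N, M ≥ 1: the real inequality s > ½ log₂ N − log₂ M.  Adding log₂ M,
-- doubling and applying the strictly increasing map x ↦ 2ˣ to both sides
-- turns it into N < (2ˢ M)².
_>½log_-log_ : ℕ → ℕ → ℕ → Set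
s >½log N -log M = N < (2 ^ s * M) ^ 2

{-# OPTIONS --safe #-}

-- Put n = 2k + c.  In a k-arc-strong tournament of order n every outdegree lies
-- in the window [k , k + c) of c values.  Choosing the arcs to later vertices
-- one vertex at a time and using C(m,w)² (m + 1) ≤ 4ᵐ, the number R of such
-- tournaments satisfies R² n! ≤ c²ⁿ 4^C(n,2).  A tournament is determined by the
-- inverted sets together with the result, so if s inversions always suffice then
-- 2^C(n,2) ≤ 2ˢⁿ R, hence n! ≤ (2ˢ c)²ⁿ.  As nⁿ < 4ⁿ n!, this forces
-- n < (2ˢ 2c)².  The extremal s exists because any tournament can be
-- transformed into any other one, in particular into a k-arc-strong one.
module Submission where

open import Data.Bool using (Bool; true; false; not; if_then_else_; _∧_; _xor_)
open import Data.Bool.Properties using (not-involutive; ∧-comm)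
open import Data.Fin using (Fin; zero; suc; combine; _≟_)
open import Data.Fin.Properties using (any?; injective⇒≤; combine-injectiveˡ; combine-injectiveʳ; 1↔⊤; 2↔Bool; *↔×)
open import Data.Fin.Subset using (Subset; Nonempty; ∁; ⁅_⁆; ⊥) renaming (_∈_ to _∈ₛ_)
open import Data.Fin.Subset.Properties using (nonempty?; x∈⁅x⁆; x∈⁅y⁆⇒x≡y)
open import Data.List as List using (List; []; _∷_; _++_; [_]; length; map; concatMap; upTo; filterᵇ; cartesianProduct)
open import Data.List.Extrema.Nat using (argmax; f[xs]≤f[argmax])
open import Data.List.Membership.Propositional using (_∈_; lose)
open import Data.List.Membership.Propositional.Properties using (∈-map⁺; ∈-++⁺ˡ; ∈-++⁺ʳ; ∈-concatMap⁺; ∈-upTo⁺; ∈-allFin)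
open import Data.List.Membership.Setoid.Properties using (index-injective)
open import Data.List.Properties using (length-++; length-map; length-upTo; filter-++)
open import Data.List.Relation.Unary.All as All using ()
open import Data.List.Relation.Unary.Any as Any using (here)
open import Data.Nat hiding (_≟_)
open import Data.Nat.Combinatorics using (_C_; nC1≡n; nCk≡nC[n∸k]; k>n⇒nCk≡0; nCk+nC[k+1]≡[n+1]C[k+1])
open import Data.Nat.Properties hiding (_≟_)
open import Data.Nat.Tactic.RingSolver using (solve-∀)
open import Data.Product using (_×_; _,_; Σ-syntax; ∃-syntax; proj₁; proj₂; uncurry)
open import Data.Product.Function.NonDependent.Propositional using (_×-↔_)
open import Data.Product.Properties using (,-injectiveˡ; ,-injectiveʳ)
open import Data.Sum using (inj₁; inj₂)
open import Data.Unit using (⊤; tt)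
open import Data.Vec as Vec using (Vec; []; _∷_; lookup; tabulate; toList; fromList)
open import Data.Vec.Properties using (lookup∘tabulate; tabulate∘lookup; tabulate-cong; lookup-map; lookup-replicate; []=⇒lookup; lookup⇒[]=; toList∘fromList; length-toList)
open import Function using (_∘_; flip; _↔_; mk↔ₛ′; Inverse; Injection; Injective)
open import Function.Properties.Inverse using (↔-sym; ↔-trans; ↔⇒↣)
open import Relation.Binary.PropositionalEquality hiding ([_])
open import Relation.Nullary using (Dec; yes; no; contradiction)
open import Relation.Nullary.Decidable using (T?; map′; _→-dec_; ¬?; decidable-stable)
open import Algebra.Properties.Semiring.Sum +-*-semiring
open import Defs

-- Arithmetic of binomial coefficients

-- The inverted sets carry only s n bits, so everything depends on how rare the possible results
-- are. A free row of m arcs has 2ᵐ forms, and confining its weight to c values leaves at most a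
-- fraction c / √(m + 1) of them. Over all rows this leaves a fraction cⁿ / √(n!), and √(n!)
-- outgrows 2ˢⁿ for bounded s. That square root is the origin of the ½ in ½ log n; working with
-- squares keeps the argument in ℕ. Vertices are removed one at a time because the arcs from a
-- vertex to the earlier ones are then already fixed: its window shifts by a known amount, and the
-- bound on its row is insensitive to the shift. The 2 in 2c is the square root of the 4 in nⁿ < 4ⁿ
-- n!. The counting needs one s that serves all tournaments at once. It is taken to be the maximum
-- itself, and the tournament attaining the maximum is the witness.

m*m≤n*n⇒m≤n : ∀ {m n} → m * m ≤ n * n → m ≤ n
m*m≤n*n⇒m≤n {m} {n} m²≤n² with m ≤? n
... | yes m≤n = m≤n
... | no m≰n = contradiction m²≤n² (<⇒≱ (*-mono-< (≰⇒> m≰n) (≰⇒> m≰n)))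

^-distribʳ-* : ∀ m n o → (m * n) ^ o ≡ m ^ o * n ^ o
^-distribʳ-* m n zero    = refl
^-distribʳ-* m n (suc o) = begin
  m * n * (m * n) ^ o         ≡⟨ cong (m * n *_) (^-distribʳ-* m n o) ⟩
  m * n * (m ^ o * n ^ o)     ≡⟨ [m*n]*[o*p]≡[m*o]*[n*p] m n (m ^ o) (n ^ o) ⟩
  m ^ suc o * n ^ suc o       ∎
  where open ≡-Reasoning

-- The absorption identity. Pascal's rule splits the left side; one copy of `x` stays aside while
-- the two induction hypotheses recombine by Pascal's rule.
[1+k]*[1+n]C[1+k]≡[1+n]*nCk : ∀ n k → suc k * (suc n C suc k) ≡ suc n * (n C k)
[1+k]*[1+n]C[1+k]≡[1+n]*nCk zero zero = refl
[1+k]*[1+n]C[1+k]≡[1+n]*nCk zero (suc k) = *-zeroʳ (suc (suc k))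
[1+k]*[1+n]C[1+k]≡[1+n]*nCk (suc n) zero = begin
  1 * (suc (suc n) C 1)     ≡⟨ *-identityˡ _ ⟩
  suc (suc n) C 1           ≡⟨ nC1≡n (suc (suc n)) ⟩
  suc (suc n)               ≡⟨ *-identityʳ _ ⟨
  suc (suc n) * 1           ∎
  where open ≡-Reasoning
[1+k]*[1+n]C[1+k]≡[1+n]*nCk (suc n) (suc k) = begin
  suc (suc k) * (suc (suc n) C suc (suc k))
    ≡⟨ cong (suc (suc k) *_) (nCk+nC[k+1]≡[n+1]C[k+1] (suc n) (suc k)) ⟨
  suc (suc k) * (x + y)
    ≡⟨ *-distribˡ-+ (suc (suc k)) x y ⟩
  x + suc k * x + suc (suc k) * y
    ≡⟨ cong₂ (λ a b → x + a + b) ([1+k]*[1+n]C[1+k]≡[1+n]*nCk n k)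
                                 ([1+k]*[1+n]C[1+k]≡[1+n]*nCk n (suc k)) ⟩
  x + suc n * (n C k) + suc n * (n C suc k)
    ≡⟨ +-assoc x _ _ ⟩
  x + (suc n * (n C k) + suc n * (n C suc k))
    ≡⟨ cong (x +_) (*-distribˡ-+ (suc n) (n C k) (n C suc k)) ⟨
  x + suc n * (n C k + n C suc k)
    ≡⟨ cong (λ z → x + suc n * z) (nCk+nC[k+1]≡[n+1]C[k+1] n k) ⟩
  suc (suc n) * x ∎
  where
  open ≡-Reasoning
  x = suc n C suc k
  y = suc n C suc (suc k)

-- The binomial coefficient indexed by the sizes of the two parts.
binom : ℕ → ℕ → ℕ
binom a b = (a + b) C b

binom-comm : ∀ a b → binom a b ≡ binom b a
binom-comm a b = begin
  (a + b) C b             ≡⟨ nCk≡nC[n∸k] (m≤n+m b a) ⟩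
  (a + b) C (a + b ∸ b)   ≡⟨ cong₂ _C_ (+-comm a b) (m+n∸n≡m a b) ⟩
  (b + a) C a             ∎
  where open ≡-Reasoning

binom-sucʳ : ∀ a b → suc b * binom a (suc b) ≡ suc (a + b) * binom a b
binom-sucʳ a b = begin
  suc b * ((a + suc b) C suc b)   ≡⟨ cong (λ n → suc b * (n C suc b)) (+-suc a b) ⟩
  suc b * (suc (a + b) C suc b)   ≡⟨ [1+k]*[1+n]C[1+k]≡[1+n]*nCk (a + b) b ⟩
  suc (a + b) * ((a + b) C b)     ∎
  where open ≡-Reasoning

-- The step from one central coefficient to the next passes through `binom (suc m) m`; symmetry
-- turns this into `binom m (suc m)`, to which the one-sided recurrence applies again.
binom-diagonal : ∀ m → suc m * binom (suc m) (suc m) ≡ 2 * (suc (m + m) * binom m m)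
binom-diagonal m = begin
  suc m * binom (suc m) (suc m)        ≡⟨ binom-sucʳ (suc m) m ⟩
  suc (suc m + m) * binom (suc m) m    ≡⟨ cong (suc (suc m + m) *_) (binom-comm (suc m) m) ⟩
  suc (suc m + m) * binom m (suc m)    ≡⟨ double m (binom m (suc m)) ⟩
  2 * (suc m * binom m (suc m))        ≡⟨ cong (2 *_) (binom-sucʳ m m) ⟩
  2 * (suc (m + m) * binom m m)        ∎
  where
  open ≡-Reasoning
  double : ∀ m x → suc (suc m + m) * x ≡ 2 * (suc m * x)
  double = solve-∀

-- With n = a + b this is C(n, b) ≤ 2ⁿ / √(n + 1), squared. It is proved along the diagonal a = b
-- and then by enlarging the larger part.
CentralBound : ℕ → ℕ → Set
CentralBound a b = binom a b * binom a b * suc (a + b) ≤ 4 ^ (a + b)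

-- Raising `b` multiplies the left side by (n + 1)(n + 2) / (b + 1)². Since `a ≤ b` gives n + 2 ≤
-- 2(b + 1), this factor is at most 4.
centralBound-offDiagonal : ∀ {a b} → a ≤ b → CentralBound a b → CentralBound a (suc b)
centralBound-offDiagonal {a} {b} a≤b bound = *-cancelˡ-≤ (suc b * suc b) (begin
  suc b * suc b * (y * y * suc (a + suc b))          ≡⟨ regroup (suc b) y (suc (a + suc b)) ⟩
  (suc b * y) * (suc b * y) * suc (a + suc b)        ≡⟨ cong₂ (λ u v → u * u * suc v) (binom-sucʳ a b) (+-suc a b) ⟩
  (suc n * x) * (suc n * x) * suc (suc n)            ≡⟨ regroup′ (suc n) x (suc (suc n)) ⟩
  (suc n * suc (suc n)) * (x * x * suc n)            ≤⟨ *-mono-≤ (*-mono-≤ (≤-trans (n≤1+n _) 2+n≤) 2+n≤) bound ⟩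
  (2 * suc b) * (2 * suc b) * 4 ^ n                  ≡⟨ regroup″ (suc b) (4 ^ n) ⟩
  suc b * suc b * 4 ^ suc n                          ≡⟨ cong (λ m → suc b * suc b * 4 ^ m) (+-suc a b) ⟨
  suc b * suc b * 4 ^ (a + suc b)                    ∎)
  where
  open ≤-Reasoning
  n = a + b
  x = binom a b
  y = binom a (suc b)
  2+n≤ : 2 + n ≤ 2 * suc b
  2+n≤ = begin
    2 + (a + b)   ≤⟨ +-monoʳ-≤ 2 (+-monoˡ-≤ b a≤b) ⟩
    2 + (b + b)   ≡⟨ lemma b ⟩
    2 * suc b     ∎
    where
    lemma : ∀ b → 2 + (b + b) ≡ 2 * suc b
    lemma = solve-∀
  regroup : ∀ u y w → u * u * (y * y * w) ≡ (u * y) * (u * y) * w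
  regroup = solve-∀
  regroup′ : ∀ u x w → (u * x) * (u * x) * w ≡ (u * w) * (x * x * u)
  regroup′ = solve-∀
  regroup″ : ∀ u w → (2 * u) * (2 * u) * w ≡ u * u * (4 * w)
  regroup″ = solve-∀

-- The left side grows by the factor 4(2m + 1)(2m + 3) / (m + 1)², which is below 16 because (2m +
-- 1)(2m + 3) = 4(m + 1)² - 1.
centralBound-diagonal : ∀ m → CentralBound m m
centralBound-diagonal zero = ≤-refl
centralBound-diagonal (suc m) = *-cancelˡ-≤ (suc m * suc m) (begin
  suc m * suc m * (y * y * suc (suc m + suc m))
    ≡⟨ regroup (suc m) y (suc (suc m + suc m)) ⟩
  (suc m * y) * (suc m * y) * suc (suc m + suc m)
    ≡⟨ cong (λ u → u * u * suc (suc m + suc m)) (binom-diagonal m) ⟩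
  (2 * (suc (m + m) * x)) * (2 * (suc (m + m) * x)) * suc (suc m + suc m)
    ≡⟨ regroup′ m x ⟩
  4 * (suc (m + m) * suc (suc m + suc m)) * (x * x * suc (m + m))
    ≤⟨ *-mono-≤ (*-monoʳ-≤ 4 (≤-trans (n≤1+n _) (≤-reflexive (square m)))) (centralBound-diagonal m) ⟩
  4 * (4 * (suc m * suc m)) * 4 ^ (m + m)
    ≡⟨ regroup″ (suc m) (4 ^ (m + m)) ⟩
  suc m * suc m * 4 ^ suc (suc (m + m))
    ≡⟨ cong (λ e → suc m * suc m * 4 ^ suc e) (+-suc m m) ⟨
  suc m * suc m * 4 ^ (suc m + suc m)  ∎)
  where
  open ≤-Reasoning
  x = binom m m
  y = binom (suc m) (suc m)
  regroup : ∀ u y w → u * u * (y * y * w) ≡ (u * y) * (u * y) * w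
  regroup = solve-∀
  regroup′ : ∀ m x → (2 * (suc (m + m) * x)) * (2 * (suc (m + m) * x)) * suc (suc m + suc m)
                   ≡ 4 * (suc (m + m) * suc (suc m + suc m)) * (x * x * suc (m + m))
  regroup′ = solve-∀
  regroup″ : ∀ u w → 4 * (4 * (u * u)) * w ≡ u * u * (4 * (4 * w))
  regroup″ = solve-∀
  square : ∀ m → suc (suc (m + m) * suc (suc m + suc m)) ≡ 4 * (suc m * suc m)
  square = solve-∀

centralBound-≤ : ∀ a b → a ≤ b → CentralBound a b
centralBound-≤ a b a≤b with m≤n⇒m<n∨m≡n a≤b
centralBound-≤ a (suc b) _ | inj₁ (s≤s a≤b) = centralBound-offDiagonal a≤b (centralBound-≤ a b a≤b)
centralBound-≤ a .a      _ | inj₂ refl      = centralBound-diagonal a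

centralBound : ∀ a b → CentralBound a b
centralBound a b with ≤-total a b
... | inj₁ a≤b = centralBound-≤ a b a≤b
... | inj₂ b≤a rewrite binom-comm a b | +-comm a b = centralBound-≤ b a b≤a

nCk²*[1+n]≤4^n : ∀ n k → (n C k) * (n C k) * suc n ≤ 4 ^ n
nCk²*[1+n]≤4^n n k with k ≤? n
... | yes k≤n = subst (λ m → (m C k) * (m C k) * suc m ≤ 4 ^ m) (m∸n+n≡m k≤n) (centralBound (n ∸ k) k)
... | no  k≰n rewrite k>n⇒nCk≡0 (≰⇒> k≰n) = z≤n

-- The right side is the product (a + 1)(a + 2)⋯(a + b), whose factors are all at least a + 1.
binom-lower : ∀ a b → suc a ^ b ≤ binom a b * b !
binom-lower a zero = ≤-refl
binom-lower a (suc b) = begin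
  suc a * suc a ^ b                    ≤⟨ *-mono-≤ (s≤s (m≤m+n a b)) (binom-lower a b) ⟩
  suc (a + b) * (binom a b * b !)      ≡⟨ *-assoc (suc (a + b)) (binom a b) (b !) ⟨
  suc (a + b) * binom a b * b !        ≡⟨ cong (_* b !) (binom-sucʳ a b) ⟨
  suc b * binom a (suc b) * b !        ≡⟨ regroup (suc b) (binom a (suc b)) (b !) ⟩
  binom a (suc b) * (suc b * b !)      ∎
  where
  open ≤-Reasoning
  regroup : ∀ u x w → u * x * w ≡ x * (u * w)
  regroup = solve-∀

binom-diagonal-upper : ∀ n → binom n n ≤ 4 ^ n
binom-diagonal-upper n = m*m≤n*n⇒m≤n (begin
  binom n n * binom n n                   ≤⟨ m≤m*n _ (suc (n + n)) ⟩
  binom n n * binom n n * suc (n + n)     ≤⟨ centralBound n n ⟩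
  4 ^ (n + n)                             ≡⟨ ^-distribˡ-+-* 4 n n ⟩
  4 ^ n * 4 ^ n                           ∎)
  where open ≤-Reasoning

-- A substitute for Stirling's formula: the case a = b = n of `binom-lower`, with C(2n, n) ≤ 4ⁿ.
n^n<4^n*n! : ∀ n → 1 ≤ n → n ^ n < 4 ^ n * n !
n^n<4^n*n! n@(suc _) _ = begin-strict
  n ^ n               <⟨ ^-monoˡ-< n (n<1+n n) ⟩
  suc n ^ n           ≤⟨ binom-lower n n ⟩
  binom n n * n !     ≤⟨ *-monoˡ-≤ (n !) (binom-diagonal-upper n) ⟩
  4 ^ n * n !         ∎
  where open ≤-Reasoning

-- Codes of tournaments with nearly constant outdegree

ind : Bool → ℕ
ind b = if b then 1 else 0

outdeg : ∀ {n} → Digraph n → Fin n → ℕ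
outdeg D u = sum λ v → ind (D u v)

-- This is x ≤ t and y ≤ m t giving x + y ≤ (m + 1) t for t = √(r / q). The cross term comes from
-- multiplying the two hypotheses and extracting the root.
+-square-bound : ∀ x y m {q r} → x * x * q ≤ r → y * y * q ≤ m * m * r →
                 (x + y) * (x + y) * q ≤ suc m * suc m * r
+-square-bound x y m {q} {r} x²q≤r y²q≤m²r = begin
  (x + y) * (x + y) * q                          ≡⟨ expand x y q ⟩
  x * x * q + 2 * (x * y * q) + y * y * q        ≤⟨ +-mono-≤ (+-mono-≤ x²q≤r (*-monoʳ-≤ 2 xyq≤mr)) y²q≤m²r ⟩
  r + 2 * (m * r) + m * m * r                    ≡⟨ collect m r ⟩
  suc m * suc m * r                              ∎
  where
  open ≤-Reasoning
  expand : ∀ x y q → (x + y) * (x + y) * q ≡ x * x * q + 2 * (x * y * q) + y * y * q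
  expand = solve-∀
  collect : ∀ m r → r + 2 * (m * r) + m * m * r ≡ suc m * suc m * r
  collect = solve-∀
  regroup : ∀ x y q → (x * y * q) * (x * y * q) ≡ (x * x * q) * (y * y * q)
  regroup = solve-∀
  regroup′ : ∀ m r → r * (m * m * r) ≡ (m * r) * (m * r)
  regroup′ = solve-∀
  xyq≤mr : x * y * q ≤ m * r
  xyq≤mr = m*m≤n*n⇒m≤n (begin
    (x * y * q) * (x * y * q)     ≡⟨ regroup x y q ⟩
    (x * x * q) * (y * y * q)     ≤⟨ *-mono-≤ x²q≤r y²q≤m²r ⟩
    r * (m * m * r)               ≡⟨ regroup′ m r ⟩
    (m * r) * (m * r)             ∎)

length-concatMap-square : ∀ {A B : Set} (f : A → List B) {q r} →
  (∀ x → length (f x) * length (f x) * q ≤ r) → ∀ xs →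
  length (concatMap f xs) * length (concatMap f xs) * q ≤ length xs * length xs * r
length-concatMap-square f bound [] = z≤n
length-concatMap-square f {q} bound (x ∷ xs)
  rewrite length-++ (f x) {concatMap f xs}
  = +-square-bound (length (f x)) _ (length xs) (bound x) (length-concatMap-square f bound xs)

vecsOfWeight : ∀ n → ℕ → List (Vec Bool n)
vecsOfWeight zero zero = [ [] ]
vecsOfWeight zero (suc w) = []
vecsOfWeight (suc n) zero = map (false ∷_) (vecsOfWeight n zero)
vecsOfWeight (suc n) (suc w) = map (true ∷_) (vecsOfWeight n w) ++ map (false ∷_) (vecsOfWeight n (suc w))

length-vecsOfWeight : ∀ n w → length (vecsOfWeight n w) ≡ n C w
length-vecsOfWeight zero zero = refl
length-vecsOfWeight zero (suc w) = refl
length-vecsOfWeight (suc n) zero = trans (length-map _ (vecsOfWeight n zero)) (length-vecsOfWeight n zero)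
length-vecsOfWeight (suc n) (suc w) = begin
  length (map (true ∷_) xs ++ map (false ∷_) ys)            ≡⟨ length-++ (map (true ∷_) xs) ⟩
  length (map (true ∷_) xs) + length (map (false ∷_) ys)    ≡⟨ cong₂ _+_ (length-map _ xs) (length-map _ ys) ⟩
  length xs + length ys                                     ≡⟨ cong₂ _+_ (length-vecsOfWeight n w) (length-vecsOfWeight n (suc w)) ⟩
  n C w + n C suc w                                         ≡⟨ nCk+nC[k+1]≡[n+1]C[k+1] n w ⟩
  suc n C suc w                                             ∎
  where
  open ≡-Reasoning
  xs = vecsOfWeight n w
  ys = vecsOfWeight n (suc w)

∈-vecsOfWeight : ∀ {n} (f : Fin n → Bool) → tabulate f ∈ vecsOfWeight n (sum (ind ∘ f))
∈-vecsOfWeight {zero} f = here refl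
∈-vecsOfWeight {suc n} f with f zero | ∈-vecsOfWeight (f ∘ suc)
... | true  | ih = ∈-++⁺ˡ (∈-map⁺ (true ∷_) ih)
... | false | ih = ∈-cons-false _ ih
  where
  -- The weight is a variable here because `vecsOfWeight (suc n)` reduces only after a case split on
  -- it.
  ∈-cons-false : ∀ w {r} → r ∈ vecsOfWeight n w → (false ∷ r) ∈ vecsOfWeight (suc n) w
  ∈-cons-false zero    r∈ = ∈-map⁺ (false ∷_) r∈
  ∈-cons-false (suc w) r∈ = ∈-++⁺ʳ (map (true ∷_) (vecsOfWeight n w)) (∈-map⁺ (false ∷_) r∈)

-- The upper triangle of the adjacency matrix of a tournament.
Code : ℕ → Set
Code zero    = ⊤
Code (suc n) = Vec Bool n × Code n

-- This is 2 to the power C(n, 2), kept as a product that unfolds along `Code` and `nearRegular`.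
codeCount : ℕ → ℕ
codeCount zero    = 1
codeCount (suc n) = 2 ^ n * codeCount n

dropVertex : ∀ {n} → Digraph (suc n) → Digraph n
dropVertex D u v = D (suc u) (suc v)

dropVertex-isTournament : ∀ {n} {D : Digraph (suc n)} → IsTournament D → IsTournament (dropVertex D)
dropVertex-isTournament tour = record
  { loopless = λ u → loopless (suc u)
  ; oriented = λ u v u≢v → oriented (suc u) (suc v) λ { refl → u≢v refl }
  }
  where open IsTournament tour

encode : ∀ {n} → Digraph n → Code n
encode {zero}  D = tt
encode {suc n} D = tabulate (λ v → D zero (suc v)) , encode (dropVertex D)

module DegreeWindow (k c : ℕ) where

  rows : ∀ n → ℕ → List (Vec Bool n)
  rows n d = concatMap (λ j → vecsOfWeight n (k + j ∸ d)) (upTo c)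

  -- Contains every tournament in which d u + outdeg u lies in [k , k + c) for
  -- all u; d u counts the out-neighbours of u among the vertices already removed.
  nearRegular : ∀ n → (Fin n → ℕ) → List (Code n)
  nearRegular zero    d = [ tt ]
  nearRegular (suc n) d =
    concatMap (λ r → map (r ,_) (nearRegular n (λ u → d (suc u) + ind (not (lookup r u)))))
              (rows n (d zero))

  length-rows : ∀ n d → length (rows n d) * length (rows n d) * suc n ≤ c * c * 4 ^ n
  length-rows n d =
    subst (λ l → length (rows n d) * length (rows n d) * suc n ≤ l * l * 4 ^ n) (length-upTo c)
      (length-concatMap-square (λ j → vecsOfWeight n (k + j ∸ d)) bound (upTo c))
    where
    bound : ∀ j → length (vecsOfWeight n (k + j ∸ d)) * length (vecsOfWeight n (k + j ∸ d)) * suc n ≤ 4 ^ n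
    bound j rewrite length-vecsOfWeight n (k + j ∸ d) = nCk²*[1+n]≤4^n n (k + j ∸ d)

  -- The bound does not depend on `d`, so the induction hypothesis covers the continuations of every
  -- first row alike. The row bound supplies the new factor n + 1 of the factorial.
  length-nearRegular : ∀ n d →
    length (nearRegular n d) * length (nearRegular n d) * n ! ≤ (c * c) ^ n * (codeCount n * codeCount n)
  length-nearRegular zero d = ≤-refl
  length-nearRegular (suc n) d = begin
    l * l * (suc n * n !)                      ≡⟨ regroup (l * l) (suc n) (n !) ⟩
    l * l * n ! * suc n                        ≤⟨ *-monoˡ-≤ (suc n) (length-concatMap-square extensions bound (rows n (d zero))) ⟩
    m * m * A * suc n                          ≡⟨ regroup₂ (m * m) A (suc n) ⟩
    m * m * suc n * A                          ≤⟨ *-monoˡ-≤ A (length-rows n (d zero)) ⟩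
    c * c * 4 ^ n * A                          ≡⟨ cong (λ x → c * c * x * A) (^-distribʳ-* 2 2 n) ⟩
    c * c * (2 ^ n * 2 ^ n) * A                ≡⟨ regroup₃ (c * c) (2 ^ n) ((c * c) ^ n) (codeCount n) ⟩
    (c * c) ^ suc n * (codeCount (suc n) * codeCount (suc n)) ∎
    where
    open ≤-Reasoning
    d′ : Vec Bool n → Fin n → ℕ
    d′ r u = d (suc u) + ind (not (lookup r u))
    extensions : Vec Bool n → List (Code (suc n))
    extensions r = map (r ,_) (nearRegular n (d′ r))
    l = length (nearRegular (suc n) d)
    m = length (rows n (d zero))
    A = (c * c) ^ n * (codeCount n * codeCount n)
    bound : ∀ r → length (extensions r) * length (extensions r) * n ! ≤ A
    bound r rewrite length-map {B = Code (suc n)} (r ,_) (nearRegular n (d′ r)) = length-nearRegular n (d′ r)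
    regroup : ∀ x y z → x * (y * z) ≡ x * z * y
    regroup = solve-∀
    regroup₂ : ∀ x y z → x * y * z ≡ x * z * y
    regroup₂ = solve-∀
    regroup₃ : ∀ x p y z → x * (p * p) * (y * (z * z)) ≡ x * y * ((p * z) * (p * z))
    regroup₃ = solve-∀

  -- The invariant is `d u + outdeg D u`: removing vertex zero moves a possible arc from `u` to it
  -- out of the outdegree and into `d`, so the window conditions pass to `dropVertex D` unchanged.
  encode∈nearRegular : ∀ {n} (D : Digraph n) → IsTournament D → (d : Fin n → ℕ) →
    (∀ u → ∃[ j ] (j < c × d u + outdeg D u ≡ k + j)) → encode D ∈ nearRegular n d
  encode∈nearRegular {zero} D tour d window = here refl
  encode∈nearRegular {suc n} D tour d window with window zero
  ... | j , j<c , d₀+outdeg≡ =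
    ∈-concatMap⁺ _ (lose row∈rows
      (∈-map⁺ (row ,_) (encode∈nearRegular (dropVertex D) (dropVertex-isTournament tour) _ window′)))
    where
    open IsTournament tour
    open ≡-Reasoning
    row = tabulate (λ v → D zero (suc v))
    weight = sum (λ v → ind (D zero (suc v)))
    weight≡ : weight ≡ k + j ∸ d zero
    weight≡ = begin
      weight                              ≡⟨ cong (λ b → ind b + weight) (loopless zero) ⟨
      outdeg D zero                       ≡⟨ m+n∸m≡n (d zero) (outdeg D zero) ⟨
      d zero + outdeg D zero ∸ d zero     ≡⟨ cong (_∸ d zero) d₀+outdeg≡ ⟩
      k + j ∸ d zero                      ∎
    row∈rows : row ∈ rows n (d zero)
    row∈rows = ∈-concatMap⁺ _ (lose (∈-upTo⁺ j<c)
      (subst (λ w → row ∈ vecsOfWeight n w) weight≡ (∈-vecsOfWeight (λ v → D zero (suc v)))))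
    window′ : ∀ u → ∃[ j ] (j < c × d (suc u) + ind (not (lookup row u)) + outdeg (dropVertex D) u ≡ k + j)
    window′ u with window (suc u)
    ... | i , i<c , eq = i , i<c , (begin
      d (suc u) + ind (not (lookup row u)) + outdeg (dropVertex D) u
        ≡⟨ cong (λ b → d (suc u) + ind (not b) + outdeg (dropVertex D) u) (lookup∘tabulate _ u) ⟩
      d (suc u) + ind (not (D zero (suc u))) + outdeg (dropVertex D) u
        ≡⟨ cong (λ b → d (suc u) + ind b + outdeg (dropVertex D) u) (oriented (suc u) zero (λ ())) ⟨
      d (suc u) + ind (D (suc u) zero) + outdeg (dropVertex D) u
        ≡⟨ +-assoc (d (suc u)) _ _ ⟩
      d (suc u) + outdeg D (suc u)
        ≡⟨ eq ⟩
      k + i ∎)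

-- Arc counts and degrees

infix 4 _≐_
_≐_ : ∀ {n} → Digraph n → Digraph n → Set
D ≐ E = ∀ u v → D u v ≡ E u v

ind-∧ : ∀ a b → ind (a ∧ b) ≡ ind a * ind b
ind-∧ true  b = sym (+-identityʳ (ind b))
ind-∧ false b = refl

ind-not : ∀ b → ind b + ind (not b) ≡ 1
ind-not true  = refl
ind-not false = refl

ind≤1 : ∀ b → ind b ≤ 1
ind≤1 true  = ≤-refl
ind≤1 false = z≤n

sum-mono-≤ : ∀ {n} {f g : Fin n → ℕ} → (∀ i → f i ≤ g i) → sum f ≤ sum g
sum-mono-≤ {zero}  f≤g = z≤n
sum-mono-≤ {suc n} f≤g = +-mono-≤ (f≤g zero) (sum-mono-≤ (f≤g ∘ suc))

sum-const : ∀ n x → sum {n} (λ _ → x) ≡ n * x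
sum-const zero    x = refl
sum-const (suc n) x = cong (x +_) (sum-const n x)

sum-⁅⁆ : ∀ {n} (u : Fin n) (f : Fin n → ℕ) → sum (λ v → ind (lookup ⁅ u ⁆ v) * f v) ≡ f u
sum-⁅⁆ {suc n} zero f = begin
  1 * f zero + sum (λ v → ind (lookup (⊥ {n}) v) * f (suc v))
    ≡⟨ cong₂ _+_ (*-identityˡ (f zero)) (sum-cong-≗ λ v → cong (λ b → ind b * f (suc v)) (lookup-replicate v false)) ⟩
  f zero + sum {n} (λ v → 0)   ≡⟨ cong (f zero +_) (sum-replicate-zero n) ⟩
  f zero + 0                   ≡⟨ +-identityʳ (f zero) ⟩
  f zero                       ∎
  where open ≡-Reasoning
sum-⁅⁆ (suc u) f = sum-⁅⁆ u (f ∘ suc)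

∈⇒1≤sum : ∀ {n} (V : Subset n) {u} → u ∈ₛ V → 1 ≤ sum (λ v → ind (lookup V v))
∈⇒1≤sum (true ∷ V) Vec.here = s≤s z≤n
∈⇒1≤sum (b ∷ V) (Vec.there u∈V) = ≤-trans (∈⇒1≤sum V u∈V) (m≤n+m _ (ind b))

length-filterᵇ-tabulate : ∀ {n} {A : Set} (p : A → Bool) (f : Fin n → A) →
  length (filterᵇ p (List.tabulate f)) ≡ sum (ind ∘ p ∘ f)
length-filterᵇ-tabulate {zero} p f = refl
length-filterᵇ-tabulate {suc n} p f with p (f zero)
... | true  = cong suc (length-filterᵇ-tabulate p (f ∘ suc))
... | false = length-filterᵇ-tabulate p (f ∘ suc)

length-filterᵇ-map : ∀ {A B : Set} (p : B → Bool) (f : A → B) xs →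
  length (filterᵇ p (map f xs)) ≡ length (filterᵇ (p ∘ f) xs)
length-filterᵇ-map p f [] = refl
length-filterᵇ-map p f (x ∷ xs) with p (f x)
... | true  = cong suc (length-filterᵇ-map p f xs)
... | false = length-filterᵇ-map p f xs

length-filterᵇ-cartesianProduct : ∀ {n} {A B : Set} (p : A × B → Bool) (f : Fin n → A) ys →
  length (filterᵇ p (cartesianProduct (List.tabulate f) ys)) ≡ sum (λ i → length (filterᵇ (λ y → p (f i , y)) ys))
length-filterᵇ-cartesianProduct {zero} p f ys = refl
length-filterᵇ-cartesianProduct {suc n} p f ys = begin
  length (filterᵇ p (map (f zero ,_) ys ++ rest))
    ≡⟨ cong length (filter-++ (T? ∘ p) (map (f zero ,_) ys) rest) ⟩
  length (filterᵇ p (map (f zero ,_) ys) ++ filterᵇ p rest)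
    ≡⟨ length-++ (filterᵇ p (map (f zero ,_) ys)) ⟩
  length (filterᵇ p (map (f zero ,_) ys)) + length (filterᵇ p rest)
    ≡⟨ cong₂ _+_ (length-filterᵇ-map p (f zero ,_) ys) (length-filterᵇ-cartesianProduct p (f ∘ suc) ys) ⟩
  sum (λ i → length (filterᵇ (λ y → p (f i , y)) ys)) ∎
  where
  open ≡-Reasoning
  rest = cartesianProduct (List.tabulate (f ∘ suc)) ys

-- As a double sum, the count can be reordered and split by linearity.
#arcs≡sum : ∀ {n} (D : Digraph n) V W →
  #arcs D V W ≡ sum (λ u → ind (lookup V u) * sum (λ v → ind (lookup W v) * ind (D u v)))
#arcs≡sum {n} D V W = begin
  #arcs D V W
    ≡⟨ length-filterᵇ-cartesianProduct {n} arc (λ u → u) (List.allFin n) ⟩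
  sum (λ u → length (filterᵇ (λ v → arc (u , v)) (List.allFin n)))
    ≡⟨ sum-cong-≗ (λ u → length-filterᵇ-tabulate {n} (λ v → arc (u , v)) (λ v → v)) ⟩
  sum (λ u → sum (λ v → ind (arc (u , v))))
    ≡⟨ sum-cong-≗ (λ u → sum-cong-≗ (λ v →
         trans (ind-∧ (lookup V u) _) (cong (ind (lookup V u) *_) (ind-∧ (lookup W v) (D u v))))) ⟩
  sum (λ u → sum (λ v → ind (lookup V u) * (ind (lookup W v) * ind (D u v))))
    ≡⟨ sum-cong-≗ (λ u → *-distribˡ-sum (ind (lookup V u)) (λ v → ind (lookup W v) * ind (D u v))) ⟨
  sum (λ u → ind (lookup V u) * sum (λ v → ind (lookup W v) * ind (D u v))) ∎
  where
  open ≡-Reasoning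
  arc : Fin n × Fin n → Bool
  arc (u , v) = lookup V u ∧ lookup W v ∧ D u v

#arcs-cong : ∀ {n} {D E : Digraph n} → D ≐ E → ∀ V W → #arcs D V W ≡ #arcs E V W
#arcs-cong {D = D} {E} D≐E V W = begin
  #arcs D V W
    ≡⟨ #arcs≡sum D V W ⟩
  sum (λ u → ind (lookup V u) * sum (λ v → ind (lookup W v) * ind (D u v)))
    ≡⟨ sum-cong-≗ (λ u → cong (ind (lookup V u) *_) (sum-cong-≗ (λ v → cong (λ b → ind (lookup W v) * ind b) (D≐E u v)))) ⟩
  sum (λ u → ind (lookup V u) * sum (λ v → ind (lookup W v) * ind (E u v)))
    ≡⟨ #arcs≡sum E V W ⟨
  #arcs E V W ∎
  where open ≡-Reasoning

#arcs-flip : ∀ {n} (D : Digraph n) V W → #arcs (flip D) V W ≡ #arcs D W V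
#arcs-flip D V W = begin
  #arcs (flip D) V W
    ≡⟨ #arcs≡sum (flip D) V W ⟩
  sum (λ u → ind (lookup V u) * sum (λ v → ind (lookup W v) * ind (D v u)))
    ≡⟨ sum-cong-≗ (λ u → *-distribˡ-sum (ind (lookup V u)) (λ v → ind (lookup W v) * ind (D v u))) ⟩
  sum (λ u → sum (λ v → ind (lookup V u) * (ind (lookup W v) * ind (D v u))))
    ≡⟨ ∑-comm (λ u v → ind (lookup V u) * (ind (lookup W v) * ind (D v u))) ⟩
  sum (λ v → sum (λ u → ind (lookup V u) * (ind (lookup W v) * ind (D v u))))
    ≡⟨ sum-cong-≗ (λ v → sum-cong-≗ (λ u → swap (ind (lookup V u)) (ind (lookup W v)) (ind (D v u)))) ⟩
  sum (λ v → sum (λ u → ind (lookup W v) * (ind (lookup V u) * ind (D v u))))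
    ≡⟨ sum-cong-≗ (λ v → *-distribˡ-sum (ind (lookup W v)) (λ u → ind (lookup V u) * ind (D v u))) ⟨
  sum (λ v → ind (lookup W v) * sum (λ u → ind (lookup V u) * ind (D v u)))
    ≡⟨ #arcs≡sum D W V ⟨
  #arcs D W V ∎
  where
  open ≡-Reasoning
  swap : ∀ x y z → x * (y * z) ≡ y * (x * z)
  swap = solve-∀

arcStrong-cong : ∀ {n k} {D E : Digraph n} → D ≐ E → ArcStrong k D → ArcStrong k E
arcStrong-cong {k = k} D≐E strong V V≢∅ ∁V≢∅ = subst (k ≤_) (#arcs-cong D≐E V (∁ V)) (strong V V≢∅ ∁V≢∅)

∁-involutive : ∀ {n} (V : Subset n) → ∁ (∁ V) ≡ V
∁-involutive []      = refl
∁-involutive (b ∷ V) = cong₂ _∷_ (not-involutive b) (∁-involutive V)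

-- The arcs leaving `V` in `flip D` are the arcs of `D` leaving the complement. Bounds on outdegrees
-- thereby become bounds on indegrees.
arcStrong-flip : ∀ {n k} {D : Digraph n} → ArcStrong k D → ArcStrong k (flip D)
arcStrong-flip {k = k} {D} strong V V≢∅ ∁V≢∅ =
  subst (k ≤_) (trans (cong (#arcs D (∁ V)) (∁-involutive V)) (sym (#arcs-flip D V (∁ V))))
    (strong (∁ V) ∁V≢∅ (subst Nonempty (sym (∁-involutive V)) V≢∅))

isTournament-flip : ∀ {n} {D : Digraph n} → IsTournament D → IsTournament (flip D)
isTournament-flip tour = record
  { loopless = loopless
  ; oriented = λ u v u≢v → oriented v u (u≢v ∘ sym)
  }
  where open IsTournament tour

-- The indicator of `⁅ u ⁆` fills the diagonal, so sums over all vertices need no exception at `u`.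
arc-trichotomy : ∀ {n} {D : Digraph n} → IsTournament D → ∀ u v →
  ind (D u v) + ind (D v u) + ind (lookup ⁅ u ⁆ v) ≡ 1
arc-trichotomy {D = D} tour u v with u ≟ v
... | yes refl rewrite IsTournament.loopless tour u | []=⇒lookup (x∈⁅x⁆ u) = refl
... | no u≢v with lookup ⁅ u ⁆ v in eq
...   | true  = contradiction (sym (x∈⁅y⁆⇒x≡y u (lookup⇒[]= v ⁅ u ⁆ eq))) u≢v
...   | false rewrite IsTournament.oriented tour u v u≢v with D v u
...     | true  = refl
...     | false = refl

outdeg+indeg : ∀ {n} {D : Digraph n} → IsTournament D → ∀ u →
  outdeg D u + outdeg (flip D) u + 1 ≡ n
outdeg+indeg {n} {D} tour u = begin
  outdeg D u + outdeg (flip D) u + 1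
    ≡⟨ cong₂ _+_ (∑-distrib-+ (λ v → ind (D u v)) (λ v → ind (D v u))) (trans (sum-cong-≗ (λ v → sym (*-identityʳ (ind (lookup ⁅ u ⁆ v))))) (sum-⁅⁆ u (λ _ → 1))) ⟨
  sum (λ v → ind (D u v) + ind (D v u)) + sum (λ v → ind (lookup ⁅ u ⁆ v))
    ≡⟨ ∑-distrib-+ (λ v → ind (D u v) + ind (D v u)) (λ v → ind (lookup ⁅ u ⁆ v)) ⟨
  sum (λ v → ind (D u v) + ind (D v u) + ind (lookup ⁅ u ⁆ v))
    ≡⟨ sum-cong-≗ (arc-trichotomy tour u) ⟩
  sum {n} (λ v → 1)
    ≡⟨ sum-const n 1 ⟩
  n * 1
    ≡⟨ *-identityʳ n ⟩
  n ∎
  where open ≡-Reasoning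

-- The cut around `u` alone consists of arcs leaving `u`; `2 ≤ n` makes the other side nonempty.
arcStrong⇒k≤outdeg : ∀ {n k} {D : Digraph n} → 2 ≤ n → ArcStrong k D → ∀ u → k ≤ outdeg D u
arcStrong⇒k≤outdeg {k = k} {D} 2≤n strong u = begin
  k                                                               ≤⟨ strong ⁅ u ⁆ (u , x∈⁅x⁆ u) (∁⁅⁆-nonempty 2≤n u) ⟩
  #arcs D ⁅ u ⁆ (∁ ⁅ u ⁆)                                         ≡⟨ #arcs≡sum D ⁅ u ⁆ (∁ ⁅ u ⁆) ⟩
  _                                                               ≡⟨ sum-⁅⁆ u (λ x → sum (λ v → ind (lookup (∁ ⁅ u ⁆) v) * ind (D x v))) ⟩
  sum (λ v → ind (lookup (∁ ⁅ u ⁆) v) * ind (D u v))              ≤⟨ sum-mono-≤ (λ v → *-monoˡ-≤ (ind (D u v)) (ind≤1 (lookup (∁ ⁅ u ⁆) v))) ⟩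
  sum (λ v → 1 * ind (D u v))                                     ≡⟨ sum-cong-≗ (λ v → *-identityˡ (ind (D u v))) ⟩
  outdeg D u                                                      ∎
  where
  open ≤-Reasoning
  ∁⁅⁆-nonempty : ∀ {n} → 2 ≤ n → (u : Fin n) → Nonempty (∁ ⁅ u ⁆)
  ∁⁅⁆-nonempty (s≤s (s≤s _)) zero    = suc zero , Vec.there Vec.here
  ∁⁅⁆-nonempty (s≤s (s≤s _)) (suc u) = zero , Vec.here

-- Indegrees are at least k too, by reversing all arcs. Outdegree and indegree sum to 2k + c - 1, so
-- the outdegree exceeds k by at most c - 1.
degreeWindow : ∀ {k c} {D : Digraph (2 * k + c)} → IsTournament D → 2 ≤ 2 * k + c → ArcStrong k D →
  ∀ u → ∃[ j ] (j < c × outdeg D u ≡ k + j)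
degreeWindow {k} {c} {D} tour 2≤n strong u with m≤n⇒∃[o]m+o≡n (arcStrong⇒k≤outdeg 2≤n strong u)
... | j , k+j≡ = j , +-cancelˡ-≤ (2 * k) (suc j) c (begin
    2 * k + suc j                           ≡⟨ regroup k j ⟩
    k + j + k + 1                           ≤⟨ +-monoˡ-≤ 1 (+-mono-≤ (≤-reflexive k+j≡) (arcStrong⇒k≤outdeg {D = flip D} 2≤n (arcStrong-flip {D = D} strong) u)) ⟩
    outdeg D u + outdeg (flip D) u + 1      ≡⟨ outdeg+indeg tour u ⟩
    2 * k + c                               ∎)
  , sym k+j≡
  where
  open ≤-Reasoning
  regroup : ∀ k j → 2 * k + suc j ≡ k + j + k + 1
  regroup = solve-∀

-- An arc-strong tournament of every order

-- By parity this says that each outdegree is at least (n - 1) / 2 rounded down, the largest common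
-- lower bound that a tournament of order n can have.
Balanced : ∀ {n} → Digraph n → Set
Balanced {n} D = ∀ u → n ≤ 2 * outdeg D u + 2

module Cut {n} {D : Digraph n} (tour : IsTournament D) (V : Subset n) where

  x y : Fin n → ℕ
  x u = ind (lookup V u)
  y u = ind (lookup (∁ V) u)

  x+y≡1 : ∀ u → x u + y u ≡ 1
  x+y≡1 u = trans (cong (λ b → x u + ind b) (lookup-map u not V)) (ind-not (lookup V u))

  sum-x+sum-y : sum x + sum y ≡ n
  sum-x+sum-y = begin
    sum x + sum y             ≡⟨ ∑-distrib-+ x y ⟨
    sum (λ u → x u + y u)     ≡⟨ sum-cong-≗ x+y≡1 ⟩
    sum {n} (λ _ → 1)         ≡⟨ sum-const n 1 ⟩
    n * 1                     ≡⟨ *-identityʳ n ⟩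
    n                         ∎
    where open ≡-Reasoning

  outdeg-split : ∀ u → outdeg D u ≡ sum (λ v → x v * ind (D u v)) + sum (λ v → y v * ind (D u v))
  outdeg-split u = begin
    sum (λ v → ind (D u v))
      ≡⟨ sum-cong-≗ (λ v → trans (cong (_* ind (D u v)) (x+y≡1 v)) (*-identityˡ (ind (D u v)))) ⟨
    sum (λ v → (x v + y v) * ind (D u v))
      ≡⟨ sum-cong-≗ (λ v → *-distribʳ-+ (ind (D u v)) (x v) (y v)) ⟩
    sum (λ v → x v * ind (D u v) + y v * ind (D u v))
      ≡⟨ ∑-distrib-+ (λ v → x v * ind (D u v)) (λ v → y v * ind (D u v)) ⟩
    sum (λ v → x v * ind (D u v)) + sum (λ v → y v * ind (D u v)) ∎
    where open ≡-Reasoning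

  sum-outdeg : sum (λ u → x u * outdeg D u) ≡ #arcs D V V + #arcs D V (∁ V)
  sum-outdeg = begin
    sum (λ u → x u * outdeg D u)
      ≡⟨ sum-cong-≗ (λ u → trans (cong (x u *_) (outdeg-split u)) (*-distribˡ-+ (x u) _ _)) ⟩
    sum (λ u → x u * sum (λ v → x v * ind (D u v)) + x u * sum (λ v → y v * ind (D u v)))
      ≡⟨ ∑-distrib-+ (λ u → x u * sum (λ v → x v * ind (D u v))) (λ u → x u * sum (λ v → y v * ind (D u v))) ⟩
    sum (λ u → x u * sum (λ v → x v * ind (D u v))) + sum (λ u → x u * sum (λ v → y v * ind (D u v)))
      ≡⟨ cong₂ _+_ (#arcs≡sum D V V) (#arcs≡sum D V (∁ V)) ⟨
    #arcs D V V + #arcs D V (∁ V) ∎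
    where open ≡-Reasoning

  ind-idem : ∀ b → ind b * ind b ≡ ind b
  ind-idem true  = refl
  ind-idem false = refl

  -- Each ordered pair of vertices of `V` is an arc, a reversed arc or a diagonal pair, exactly one
  -- of the three.
  arcs-inside : #arcs D V V + #arcs D V V + sum x ≡ sum x * sum x
  arcs-inside = begin
    #arcs D V V + #arcs D V V + sum x
      ≡⟨ cong (λ e → #arcs D V V + e + sum x) (#arcs-flip D V V) ⟨
    #arcs D V V + #arcs (flip D) V V + sum x
      ≡⟨ cong₂ _+_ (cong₂ _+_ (#arcs≡sum D V V) (#arcs≡sum (flip D) V V)) (sum-cong-≗ (λ u → sym (ind-idem (lookup V u)))) ⟩
    sum (λ u → x u * out u) + sum (λ u → x u * into u) + sum (λ u → x u * x u)
      ≡⟨ cong (_+ sum (λ u → x u * x u)) (∑-distrib-+ (λ u → x u * out u) (λ u → x u * into u)) ⟨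
    sum (λ u → x u * out u + x u * into u) + sum (λ u → x u * x u)
      ≡⟨ ∑-distrib-+ (λ u → x u * out u + x u * into u) (λ u → x u * x u) ⟨
    sum (λ u → x u * out u + x u * into u + x u * x u)
      ≡⟨ sum-cong-≗ (λ u → trans (factor (x u) (out u) (into u) (x u)) (cong (x u *_) (row u))) ⟩
    sum (λ u → x u * sum x)
      ≡⟨ *-distribʳ-sum (sum x) x ⟨
    sum x * sum x ∎
    where
    open ≡-Reasoning
    out into : Fin n → ℕ
    out  u = sum (λ v → x v * ind (D u v))
    into u = sum (λ v → x v * ind (D v u))
    factor : ∀ x a b c → x * a + x * b + x * c ≡ x * (a + b + c)
    factor = solve-∀
    expand : ∀ x a b c → x * a + x * b + c * x ≡ x * (a + b + c)
    expand = solve-∀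
    row : ∀ u → out u + into u + x u ≡ sum x
    row u = begin
      out u + into u + x u
        ≡⟨ cong₂ _+_ (∑-distrib-+ (λ v → x v * ind (D u v)) (λ v → x v * ind (D v u))) (sum-⁅⁆ u x) ⟨
      sum (λ v → x v * ind (D u v) + x v * ind (D v u)) + sum (λ v → ind (lookup ⁅ u ⁆ v) * x v)
        ≡⟨ ∑-distrib-+ (λ v → x v * ind (D u v) + x v * ind (D v u)) (λ v → ind (lookup ⁅ u ⁆ v) * x v) ⟨
      sum (λ v → x v * ind (D u v) + x v * ind (D v u) + ind (lookup ⁅ u ⁆ v) * x v)
        ≡⟨ sum-cong-≗ (λ v → trans (expand (x v) (ind (D u v)) (ind (D v u)) (ind (lookup ⁅ u ⁆ v)))
                                   (trans (cong (x v *_) (arc-trichotomy tour u v)) (*-identityʳ (x v)))) ⟩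
      sum x ∎

  -- The outdegrees over `V` add up to the arcs inside `V` plus the cut. The inside arcs number a(a
  -- - 1) / 2, which leaves at least a(b - 1) / 2 for the cut.
  cut-lower : Balanced D → sum x * sum y ≤ 2 * #arcs D V (∁ V) + sum x
  cut-lower balanced = +-cancelˡ-≤ (a * a) (a * b) (2 * cut + a) (begin
    a * a + a * b                                   ≡⟨ *-distribˡ-+ a a b ⟨
    a * (a + b)                                     ≡⟨ cong (a *_) sum-x+sum-y ⟩
    a * n                                           ≡⟨ *-distribʳ-sum n x ⟩
    sum (λ u → x u * n)                             ≤⟨ sum-mono-≤ (λ u → *-monoʳ-≤ (x u) (balanced u)) ⟩
    sum (λ u → x u * (2 * outdeg D u + 2))          ≡⟨ sum-cong-≗ (λ u → expand (x u) (outdeg D u)) ⟩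
    sum (λ u → 2 * (x u * outdeg D u) + 2 * x u)    ≡⟨ ∑-distrib-+ (λ u → 2 * (x u * outdeg D u)) (λ u → 2 * x u) ⟩
    _                                               ≡⟨ cong₂ _+_ (*-distribˡ-sum 2 (λ u → x u * outdeg D u)) (*-distribˡ-sum 2 x) ⟨
    2 * sum (λ u → x u * outdeg D u) + 2 * a        ≡⟨ cong (λ e → 2 * e + 2 * a) sum-outdeg ⟩
    2 * (inside + cut) + 2 * a                      ≡⟨ regroup inside cut a ⟩
    (inside + inside + a) + (2 * cut + a)           ≡⟨ cong (_+ (2 * cut + a)) arcs-inside ⟩
    a * a + (2 * cut + a)                           ∎)
    where
    open ≤-Reasoning
    a = sum x
    b = sum y
    inside = #arcs D V V
    cut = #arcs D V (∁ V)
    expand : ∀ x d → x * (2 * d + 2) ≡ 2 * (x * d) + 2 * x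
    expand = solve-∀
    regroup : ∀ i c a → 2 * (i + c) + 2 * a ≡ (i + i + a) + (2 * c + a)
    regroup = solve-∀

2m≤1+2n⇒m≤n : ∀ {m n} → 2 * m ≤ suc (2 * n) → m ≤ n
2m≤1+2n⇒m≤n {m} {n} le = ≮⇒≥ λ n<m → <-irrefl refl (begin-strict
  suc (2 * n)       <⟨ n<1+n _ ⟩
  suc (suc (2 * n)) ≡⟨ *-suc 2 n ⟨
  2 * suc n         ≤⟨ *-monoʳ-≤ 2 n<m ⟩
  2 * m             ≤⟨ le ⟩
  suc (2 * n)       ∎)
  where open ≤-Reasoning

-- With parts of sizes p + 1 and q + 1, `cut-lower` for `D` and for its reversal gives twice the cut
-- at least (p + 1)q and at least (q + 1)p, hence at least p + q = n - 2. As 2k ≤ n - 1, this falls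
-- one short of twice k, and parity makes up the difference.
balanced⇒arcStrong : ∀ {n k} {D : Digraph n} → IsTournament D → Balanced D → Balanced (flip D) →
  2 * k + 1 ≤ n → ArcStrong k D
balanced⇒arcStrong {n} {k} {D} tour out into 2k+1≤n V (u , u∈V) (w , w∈∁V) =
  2m≤1+2n⇒m≤n (begin
    2 * k                                     ≤⟨ +-cancelʳ-≤ 1 (2 * k) _ (≤-trans 2k+1≤n (≤-reflexive n≡)) ⟩
    suc (p + q)                               ≤⟨ s≤s (p+q≤ p q (cut-lower′) (cut-lower″)) ⟩
    suc (2 * #arcs D V (∁ V))                 ∎)
  where
  open ≤-Reasoning
  open Cut tour V
  a = sum x
  b = sum y
  p = pred a
  q = pred b
  1≤a : 1 ≤ a
  1≤a = ∈⇒1≤sum V u∈V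
  1≤b : 1 ≤ b
  1≤b = ∈⇒1≤sum (∁ V) w∈∁V
  1+p≡a : suc p ≡ a
  1+p≡a = suc-pred a {{>-nonZero 1≤a}}
  1+q≡b : suc q ≡ b
  1+q≡b = suc-pred b {{>-nonZero 1≤b}}
  regroup : ∀ p q → suc p + suc q ≡ suc (p + q) + 1
  regroup = solve-∀
  n≡ : n ≡ suc (p + q) + 1
  n≡ = trans (sym sum-x+sum-y) (trans (sym (cong₂ _+_ 1+p≡a 1+q≡b)) (regroup p q))
  cut = #arcs D V (∁ V)
  cut-lower′ : suc p * suc q ≤ 2 * cut + suc p
  cut-lower′ = subst₂ (λ a b → a * b ≤ 2 * cut + a) (sym 1+p≡a) (sym 1+q≡b) (cut-lower out)
  flipped : #arcs (flip D) (∁ V) (∁ (∁ V)) ≡ cut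
  flipped = trans (#arcs-flip D (∁ V) (∁ (∁ V))) (cong (λ W → #arcs D W (∁ V)) (∁-involutive V))
  cut-lower″ : suc q * suc p ≤ 2 * cut + suc q
  cut-lower″ = subst₂ (λ a b → b * a ≤ 2 * cut + b) (sym 1+p≡a) (sym 1+q≡b)
    (subst₂ (λ e a → b * a ≤ 2 * e + b) flipped (cong (λ W → sum (λ u → ind (lookup W u))) (∁-involutive V))
      (Cut.cut-lower (isTournament-flip tour) (∁ V) into))
  p+q≤ : ∀ p q → suc p * suc q ≤ 2 * cut + suc p → suc q * suc p ≤ 2 * cut + suc q → p + q ≤ 2 * cut
  -- For q = 0 the inequality from `D` gives nothing; the one from the reversal gives p. For q > 0
  -- the first one suffices, as (p + 1)q ≥ p + q.
  p+q≤ p zero _ le = +-cancelʳ-≤ 1 (p + 0) (2 * cut) (begin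
    p + 0 + 1      ≡⟨ lemma p ⟩
    1 * suc p      ≤⟨ le ⟩
    2 * cut + 1    ∎)
    where
    lemma : ∀ p → p + 0 + 1 ≡ 1 * suc p
    lemma = solve-∀
  p+q≤ p (suc q) le _ = +-cancelʳ-≤ (suc p) (p + suc q) (2 * cut) (begin
    p + suc q + suc p                ≤⟨ m≤m+n _ (p * q) ⟩
    p + suc q + suc p + p * q        ≡⟨ lemma p q ⟩
    suc p * suc (suc q)              ≤⟨ le ⟩
    2 * cut + suc p                  ∎)
    where
    lemma : ∀ p q → p + suc q + suc p + p * q ≡ suc p * suc (suc q)
    lemma = solve-∀

-- The alternating tournament

even : ∀ {n} → Fin n → Bool
even zero    = true
even (suc v) = not (even v)

-- For u < v the arc goes from u to v exactly when v − u is odd.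
alternating : ∀ {n} → Digraph n
alternating zero    zero    = false
alternating zero    (suc v) = even v
alternating (suc u) zero    = not (even u)
alternating (suc u) (suc v) = alternating u v

alternating-isTournament : ∀ {n} → IsTournament (alternating {n})
alternating-isTournament = record { loopless = loopless ; oriented = oriented }
  where
  loopless : ∀ {n} (u : Fin n) → alternating u u ≡ false
  loopless zero    = refl
  loopless (suc u) = loopless u
  oriented : ∀ {n} (u v : Fin n) → u ≢ v → alternating u v ≡ not (alternating v u)
  oriented zero    zero    u≢v = contradiction refl u≢v
  oriented zero    (suc v) u≢v = sym (not-involutive (even v))
  oriented (suc u) zero    u≢v = refl
  oriented (suc u) (suc v) u≢v = oriented u v (u≢v ∘ cong suc)

evens : ℕ → ℕ
evens n = sum {n} (ind ∘ even)

2*evens[2+n] : ∀ n → 2 * evens (2 + n) ≡ 2 + 2 * evens n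
2*evens[2+n] n = trans (cong (2 *_) (cong suc (sum-cong-≗ {n} (λ v → cong ind (not-involutive (even v))))))
                       (*-suc 2 (evens n))

n≤2*evens : ∀ n → n ≤ 2 * evens n
n≤2*evens zero = z≤n
n≤2*evens (suc zero) = s≤s z≤n
n≤2*evens (suc (suc n)) =
  subst (2 + n ≤_) (sym (2*evens[2+n] n)) (s≤s (s≤s (n≤2*evens n)))

2*evens≤1+n : ∀ n → 2 * evens n ≤ suc n
2*evens≤1+n zero = z≤n
2*evens≤1+n (suc zero) = ≤-refl
2*evens≤1+n (suc (suc n)) =
  subst (_≤ 3 + n) (sym (2*evens[2+n] n)) (s≤s (s≤s (2*evens≤1+n n)))

-- The two new vertices differ in parity, so exactly one of them is an out-neighbour of the shifted
-- `u`.
2*outdeg-alternating[2+u] : ∀ {n} (u : Fin n) →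
  2 * outdeg alternating (suc (suc u)) ≡ 2 + 2 * outdeg alternating u
2*outdeg-alternating[2+u] u = trans (cong (2 *_) outdeg≡) (*-suc 2 (outdeg alternating u))
  where
  outdeg≡ : outdeg alternating (suc (suc u)) ≡ suc (outdeg alternating u)
  outdeg≡ with even u
  ... | true  = refl
  ... | false = refl

alternating-balanced : ∀ {n} → Balanced (alternating {n})
alternating-balanced {suc n} zero = begin
  suc n              ≤⟨ n≤1+n _ ⟩
  2 + n              ≤⟨ +-monoʳ-≤ 2 (n≤2*evens n) ⟩
  2 + 2 * evens n    ≡⟨ +-comm 2 _ ⟩
  2 * evens n + 2    ∎
  where open ≤-Reasoning
alternating-balanced {suc (suc n)} (suc zero) = begin
  2 + n              ≤⟨ +-monoʳ-≤ 2 (n≤2*evens n) ⟩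
  2 + 2 * evens n    ≡⟨ +-comm 2 _ ⟩
  2 * evens n + 2    ∎
  where open ≤-Reasoning
alternating-balanced {suc (suc n)} (suc (suc u)) =
  subst (λ d → 2 + n ≤ d + 2) (sym (2*outdeg-alternating[2+u] u)) (s≤s (s≤s (alternating-balanced u)))

2*outdeg-alternating≤n : ∀ {n} (u : Fin n) → 2 * outdeg alternating u ≤ n
2*outdeg-alternating≤n {suc n} zero = 2*evens≤1+n n
2*outdeg-alternating≤n {suc (suc n)} (suc zero) = m≤n⇒m≤1+n (2*evens≤1+n n)
2*outdeg-alternating≤n {suc (suc n)} (suc (suc u)) =
  subst (_≤ 2 + n) (sym (2*outdeg-alternating[2+u] u)) (s≤s (s≤s (2*outdeg-alternating≤n u)))

-- An outdegree of at most n / 2 leaves at least n / 2 - 1 for the indegree.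
alternating-balanced-flip : ∀ {n} → Balanced (flip (alternating {n}))
alternating-balanced-flip {n} u = +-cancelˡ-≤ n n (2 * i + 2) (begin
  n + n                        ≡⟨ cong₂ _+_ n≡ n≡ ⟨
  (o + i + 1) + (o + i + 1)    ≡⟨ regroup o i ⟩
  2 * o + (2 * i + 2)          ≤⟨ +-monoˡ-≤ (2 * i + 2) (2*outdeg-alternating≤n u) ⟩
  n + (2 * i + 2)              ∎)
  where
  open ≤-Reasoning
  o = outdeg alternating u
  i = outdeg (flip alternating) u
  n≡ = outdeg+indeg alternating-isTournament u
  regroup : ∀ o i → (o + i + 1) + (o + i + 1) ≡ 2 * o + (2 * i + 2)
  regroup = solve-∀

alternating-arcStrong : ∀ {n k} → 2 * k + 1 ≤ n → ArcStrong k (alternating {n})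
alternating-arcStrong =
  balanced⇒arcStrong alternating-isTournament alternating-balanced alternating-balanced-flip

-- Inversions

invert-cong : ∀ {n} {D E : Digraph n} → D ≐ E → ∀ X → invert D X ≐ invert E X
invert-cong D≐E X u v with lookup X u ∧ lookup X v
... | true  = D≐E v u
... | false = D≐E u v

invertAll-cong : ∀ {n} {D E : Digraph n} → D ≐ E → ∀ Xs → invertAll D Xs ≐ invertAll E Xs
invertAll-cong D≐E []       = D≐E
invertAll-cong D≐E (X ∷ Xs) = invertAll-cong (invert-cong D≐E X) Xs

invert-involutive : ∀ {n} (D : Digraph n) X → invert (invert D X) X ≐ D
invert-involutive D X u v rewrite ∧-comm (lookup X v) (lookup X u) with lookup X u ∧ lookup X v
... | true  = refl
... | false = refl

invert-injective : ∀ {n} {D E : Digraph n} X → invert D X ≐ invert E X → D ≐ E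
invert-injective {D = D} {E} X eq u v =
  trans (sym (invert-involutive D X u v)) (trans (invert-cong eq X u v) (invert-involutive E X u v))

invertAll-injective : ∀ {n} {D E : Digraph n} Xs → invertAll D Xs ≐ invertAll E Xs → D ≐ E
invertAll-injective []       eq = eq
invertAll-injective (X ∷ Xs) eq = invert-injective X (invertAll-injective Xs eq)

invert-⊥ : ∀ {n} (D : Digraph n) → D ≐ invert D ⊥
invert-⊥ D u v rewrite lookup-replicate u false = refl

invert-isTournament : ∀ {n} {D : Digraph n} → IsTournament D → ∀ X → IsTournament (invert D X)
invert-isTournament {D = D} tour X = record { loopless = loopless′ ; oriented = oriented′ }
  where
  open IsTournament tour
  loopless′ : ∀ u → invert D X u u ≡ false
  loopless′ u with lookup X u ∧ lookup X u
  ... | true  = loopless u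
  ... | false = loopless u
  oriented′ : ∀ u v → u ≢ v → invert D X u v ≡ not (invert D X v u)
  oriented′ u v u≢v rewrite ∧-comm (lookup X v) (lookup X u) with lookup X u ∧ lookup X v
  ... | true  = oriented v u (u≢v ∘ sym)
  ... | false = oriented u v u≢v

invertAll-isTournament : ∀ {n} {D : Digraph n} → IsTournament D → ∀ Xs → IsTournament (invertAll D Xs)
invertAll-isTournament tour []       = tour
invertAll-isTournament tour (X ∷ Xs) = invertAll-isTournament (invert-isTournament tour X) Xs

-- Codes correspond to tournaments

tabulate-injective : ∀ {A : Set} {n} {f g : Fin n → A} → tabulate f ≡ tabulate g → f ≗ g
tabulate-injective {f = f} {g} eq i =
  trans (sym (lookup∘tabulate f i)) (trans (cong (λ v → lookup v i) eq) (lookup∘tabulate g i))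

encode-injective : ∀ {n} {D E : Digraph n} → IsTournament D → IsTournament E → encode D ≡ encode E → D ≐ E
encode-injective {suc n} {D} {E} tourD tourE eq = pointwise
  where
  open IsTournament
  row : ∀ v → D zero (suc v) ≡ E zero (suc v)
  row = tabulate-injective (,-injectiveˡ eq)
  pointwise : D ≐ E
  pointwise zero    zero    = trans (loopless tourD zero) (sym (loopless tourE zero))
  pointwise zero    (suc v) = row v
  pointwise (suc u) zero    =
    trans (oriented tourD (suc u) zero λ ()) (trans (cong not (row u)) (sym (oriented tourE (suc u) zero λ ())))
  pointwise (suc u) (suc v) =
    encode-injective (dropVertex-isTournament tourD) (dropVertex-isTournament tourE) (,-injectiveʳ eq) u v

encode-cong : ∀ {n} {D E : Digraph n} → D ≐ E → encode D ≡ encode E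
encode-cong {zero}  D≐E = refl
encode-cong {suc n} D≐E =
  cong₂ _,_ (tabulate-cong (λ v → D≐E zero (suc v))) (encode-cong (λ u v → D≐E (suc u) (suc v)))

decode : ∀ {n} → Code n → Digraph n
decode (r , t) zero    zero    = false
decode (r , t) zero    (suc v) = lookup r v
decode (r , t) (suc u) zero    = not (lookup r u)
decode (r , t) (suc u) (suc v) = decode t u v

decode-isTournament : ∀ {n} (t : Code n) → IsTournament (decode t)
decode-isTournament {n} t = record { loopless = loopless t ; oriented = oriented t }
  where
  loopless : ∀ {n} (t : Code n) u → decode t u u ≡ false
  loopless (r , t) zero    = refl
  loopless (r , t) (suc u) = loopless t u
  oriented : ∀ {n} (t : Code n) u v → u ≢ v → decode t u v ≡ not (decode t v u)
  oriented (r , t) zero    zero    u≢v = contradiction refl u≢v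
  oriented (r , t) zero    (suc v) u≢v = sym (not-involutive (lookup r v))
  oriented (r , t) (suc u) zero    u≢v = refl
  oriented (r , t) (suc u) (suc v) u≢v = oriented t u v (u≢v ∘ cong suc)

encode∘decode : ∀ {n} (t : Code n) → encode (decode t) ≡ t
encode∘decode {zero}  tt      = refl
encode∘decode {suc n} (r , t) = cong₂ _,_ (tabulate∘lookup r) (encode∘decode t)

decode∘encode : ∀ {n} {D : Digraph n} → IsTournament D → decode (encode D) ≐ D
decode∘encode {D = D} tour =
  encode-injective (decode-isTournament (encode D)) tour (encode∘decode (encode D))

-- One inversion makes the arcs at the first vertex agree; the sets inverted
-- afterwards avoid that vertex.
connect : ∀ {n} {D E : Digraph n} → IsTournament D → IsTournament E →
  Σ[ Xs ∈ List (Subset n) ] length Xs ≡ n × encode (invertAll D Xs) ≡ encode E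
connect {zero} tourD tourE = [] , refl , refl
connect {suc n} {D} {E} tourD tourE
  with connect (dropVertex-isTournament (invert-isTournament tourD (true ∷ differ))) (dropVertex-isTournament tourE)
  where
  differ : Vec Bool n
  differ = tabulate (λ v → D zero (suc v) xor E zero (suc v))
... | Xs , length≡ , eq =
  X ∷ map (false ∷_) Xs ,
  cong suc (trans (length-map _ Xs) length≡) ,
  cong₂ _,_ (trans (tabulate-cong (λ v → row D′ Xs (suc v))) (tabulate-cong agree))
            (trans (rest D′ Xs) eq)
  where
  X : Subset (suc n)
  X = true ∷ tabulate (λ v → D zero (suc v) xor E zero (suc v))
  D′ = invert D X
  row : ∀ D Xs v → invertAll D (map (false ∷_) Xs) zero v ≡ D zero v
  row D []       v = refl
  row D (X ∷ Xs) v = row (invert D (false ∷ X)) Xs v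
  rest : ∀ D Xs → encode (dropVertex (invertAll D (map (false ∷_) Xs))) ≡ encode (invertAll (dropVertex D) Xs)
  rest D []       = refl
  rest D (X ∷ Xs) = rest (invert D (false ∷ X)) Xs
  agree : ∀ v → D′ zero (suc v) ≡ E zero (suc v)
  agree v rewrite lookup∘tabulate (λ v → D zero (suc v) xor E zero (suc v)) v
                | IsTournament.oriented tourD (suc v) zero (λ ())
    with D zero (suc v) | E zero (suc v)
  ... | true  | true  = refl
  ... | true  | false = refl
  ... | false | true  = refl
  ... | false | false = refl

invertibleIn-cong : ∀ {n k s} {D E : Digraph n} → D ≐ E → InvertibleIn k D s → InvertibleIn k E s
invertibleIn-cong D≐E (Xs , length≡ , strong) =
  Xs , length≡ , arcStrong-cong (invertAll-cong D≐E Xs) strong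

-- Empty sets serve as padding, since inverting them changes nothing. This lets every tournament use
-- the same number of sets in the counting.
invertibleIn-mono : ∀ {n k s t} {D : Digraph n} → s ≤′ t → InvertibleIn k D s → InvertibleIn k D t
invertibleIn-mono ≤′-refl inv = inv
invertibleIn-mono {D = D} (≤′-step s≤t) inv with invertibleIn-mono s≤t inv
... | Xs , length≡ , strong =
  ⊥ ∷ Xs , cong suc length≡ , arcStrong-cong (invertAll-cong (invert-⊥ D) Xs) strong

invertibleIn-order : ∀ {n k} {D : Digraph n} → 2 * k + 1 ≤ n → IsTournament D → InvertibleIn k D n
invertibleIn-order 2k+1≤n tour with connect tour alternating-isTournament
... | Xs , length≡ , eq = Xs , length≡ , arcStrong-cong alternating≐ (alternating-arcStrong 2k+1≤n)
  where
  alternating≐ : alternating ≐ invertAll _ Xs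
  alternating≐ u v =
    sym (encode-injective (invertAll-isTournament tour Xs) alternating-isTournament eq u v)

-- Finiteness and decidability

Vec↔Fin : ∀ {A : Set} {m} → A ↔ Fin m → ∀ n → Vec A n ↔ Fin (m ^ n)
Vec↔Fin A↔Fin zero = mk↔ₛ′ (λ _ → zero) (λ _ → []) (λ { zero → refl }) (λ { [] → refl })
Vec↔Fin A↔Fin (suc n) =
  ↔-trans (mk↔ₛ′ Vec.uncons (uncurry _∷_) (λ _ → refl) (λ { (x ∷ xs) → refl }))
  (↔-trans (A↔Fin ×-↔ Vec↔Fin A↔Fin n) (↔-sym *↔×))

Subset↔Fin : ∀ n → Subset n ↔ Fin (2 ^ n)
Subset↔Fin = Vec↔Fin (↔-sym 2↔Bool)

Code↔Fin : ∀ n → Code n ↔ Fin (codeCount n)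
Code↔Fin zero    = ↔-sym 1↔⊤
Code↔Fin (suc n) = ↔-trans (Subset↔Fin n ×-↔ Code↔Fin n) (↔-sym *↔×)

∃-dec : ∀ {A : Set} {m} {P : A → Set} → A ↔ Fin m → (∀ x → Dec (P x)) → Dec (∃[ x ] P x)
∃-dec {P = P} A↔Fin P? = map′
  (λ (i , p) → from i , p)
  (λ (x , p) → to x , subst P (sym (strictlyInverseʳ x)) p)
  (any? (P? ∘ from))
  where open Inverse A↔Fin

∀-dec : ∀ {A : Set} {m} {P : A → Set} → A ↔ Fin m → (∀ x → Dec (P x)) → Dec (∀ x → P x)
∀-dec A↔Fin P? = map′
  (λ ¬∃¬ x → decidable-stable (P? x) (λ ¬p → ¬∃¬ (x , ¬p)))
  (λ ∀p (x , ¬p) → ¬p (∀p x))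
  (¬? (∃-dec A↔Fin (¬? ∘ P?)))

-- The second key lands in `Fin l` because it will be a position in a list of length `l`; a list
-- length then acts as a count even if entries repeat.
card-≤ : ∀ {A B : Set} {a b l} → A ↔ Fin a → B ↔ Fin b → (g : A → B) (h : A → Fin l) →
  (∀ x y → g x ≡ g y → h x ≡ h y → x ≡ y) → a ≤ b * l
card-≤ {a = a} {b} {l} A↔Fin B↔Fin g h jointlyInjective = injective⇒≤ {f = f} f-injective
  where
  module A = Inverse A↔Fin
  module B = Inverse B↔Fin
  f : Fin a → Fin (b * l)
  f i = combine (B.to (g (A.from i))) (h (A.from i))
  f-injective : Injective _≡_ _≡_ f
  f-injective {i} {j} eq = Injection.injective (↔⇒↣ (↔-sym A↔Fin)) (jointlyInjective (A.from i) (A.from j)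
    (Injection.injective (↔⇒↣ B↔Fin) (combine-injectiveˡ (B.to (g (A.from i))) _ (B.to (g (A.from j))) _ eq))
    (combine-injectiveʳ (B.to (g (A.from i))) (h (A.from i)) (B.to (g (A.from j))) (h (A.from j)) eq))

-- Existence of the minimum and of the maximum

arcStrong? : ∀ {n} k (D : Digraph n) → Dec (ArcStrong k D)
arcStrong? {n} k D = ∀-dec (Subset↔Fin n) λ V →
  nonempty? V →-dec nonempty? (∁ V) →-dec k ≤? #arcs D V (∁ V)

-- Vectors of a fixed length form a finite type, so the search for suitable sets is decidable and
-- the choices can be counted.
InvertibleInᵛ : ∀ {n} → ℕ → Digraph n → ℕ → Set
InvertibleInᵛ {n} k D s = Σ[ Xs ∈ Vec (Subset n) s ] ArcStrong k (invertAll D (toList Xs))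

toVec : ∀ {n k s} {D : Digraph n} → InvertibleIn k D s → InvertibleInᵛ k D s
toVec {k = k} {D = D} (Xs , refl , strong) =
  fromList Xs , subst (λ Ys → ArcStrong k (invertAll D Ys)) (sym (toList∘fromList Xs)) strong

fromVec : ∀ {n k s} {D : Digraph n} → InvertibleInᵛ k D s → InvertibleIn k D s
fromVec (Xs , strong) = toList Xs , trans (length-toList Xs) (length≡ Xs) , strong
  where
  length≡ : ∀ {A : Set} {m} (xs : Vec A m) → Vec.length xs ≡ m
  length≡ []       = refl
  length≡ (x ∷ xs) = cong suc (length≡ xs)

invertibleIn? : ∀ {n} k (D : Digraph n) s → Dec (InvertibleIn k D s)
invertibleIn? {n} k D s = map′ fromVec toVec
  (∃-dec (Vec↔Fin (Subset↔Fin n) s) (λ Xs → arcStrong? k (invertAll D (toList Xs))))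

least : ∀ {P : ℕ → Set} → (∀ n → Dec (P n)) → ∀ n → P n → ∃[ m ] IsMinimum P m
least P? zero p = zero , p , λ _ _ → z≤n
least {P} P? (suc n) p with P? zero
... | yes p₀ = zero , p₀ , λ _ _ → z≤n
... | no ¬p₀ with least {P ∘ suc} (P? ∘ suc) n p
...   | m , pm , minimal = suc m , pm , minimal′
  where
  minimal′ : ∀ j → P j → suc m ≤ j
  minimal′ zero    p₀ = contradiction p₀ ¬p₀
  minimal′ (suc j) pj = s≤s (minimal j pj)

sinv′-exists : ∀ {n k} {D : Digraph n} → 2 * k + 1 ≤ n → IsTournament D → ∃[ s ] Sinv′ k D s
sinv′-exists {n} {k} {D} 2k+1≤n tour = least (invertibleIn? k D) n (invertibleIn-order 2k+1≤n tour)

-- Maximizing over codes reaches every tournament: each agrees pointwise with its decoded code, and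
-- invertibility transfers along pointwise equality.
m′-exists : ∀ {n k} → 2 * k + 1 ≤ n → ∃[ m ] M′ k n m
m′-exists {n} {k} 2k+1≤n =
  sinv′ best , (decode best , decode-isTournament best , proj₂ (exists best)) , maximal
  where
  open Inverse (Code↔Fin n)
  exists : (t : Code n) → ∃[ s ] Sinv′ k (decode t) s
  exists t = sinv′-exists 2k+1≤n (decode-isTournament t)
  sinv′ : Code n → ℕ
  sinv′ t = proj₁ (exists t)
  codes : List (Code n)
  codes = map from (List.allFin (codeCount n))
  best : Code n
  -- The default of `argmax` is the code of a tournament available in every order; `codes` already
  -- lists all codes.
  best = argmax sinv′ (encode alternating) codes
  ∈codes : ∀ t → t ∈ codes
  ∈codes t = subst (_∈ codes) (strictlyInverseʳ t) (∈-map⁺ from (∈-allFin (to t)))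
  maximal : ∀ j → ∃[ D ] (IsTournament {n} D × Sinv′ k D j) → j ≤ sinv′ best
  maximal j (D , tour , _ , minimal) = ≤-trans
    (minimal (sinv′ t) (invertibleIn-cong (decode∘encode tour) (proj₁ (proj₂ (exists t)))))
    (All.lookup (f[xs]≤f[argmax] {f = sinv′} (encode alternating) codes) (∈codes t))
    where t = encode D

-- The counting argument

codeCount≢0 : ∀ n → NonZero (codeCount n)
codeCount≢0 zero    = _
codeCount≢0 (suc n) = m*n≢0 (2 ^ n) (codeCount n) {{m^n≢0 2 n}} {{codeCount≢0 n}}

module Counting {k c s : ℕ} (2≤n : 2 ≤ 2 * k + c)
  (invertible : ∀ t → InvertibleIn k (decode {2 * k + c} t) s) where

  open DegreeWindow k c

  n : ℕ
  n = 2 * k + c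

  strongCodes : List (Code n)
  strongCodes = nearRegular n (λ _ → 0)

  sets : Code n → Vec (Subset n) s
  sets t = proj₁ (toVec (invertible t))

  result : Code n → Digraph n
  result t = invertAll (decode t) (toList (sets t))

  result-isTournament : ∀ t → IsTournament (result t)
  result-isTournament t = invertAll-isTournament (decode-isTournament t) (toList (sets t))

  result∈ : ∀ t → encode (result t) ∈ strongCodes
  result∈ t = encode∈nearRegular (result t) (result-isTournament t) (λ _ → 0)
    (degreeWindow (result-isTournament t) 2≤n (proj₂ (toVec (invertible t))))

  determined : ∀ {t t′} → sets t ≡ sets t′ → encode (result t) ≡ encode (result t′) → t ≡ t′
  determined {t} {t′} sets≡ codes≡ = begin
    t                       ≡⟨ encode∘decode t ⟨
    encode (decode t)       ≡⟨ encode-cong (invertAll-injective (toList (sets t)) results≐) ⟩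
    encode (decode t′)      ≡⟨ encode∘decode t′ ⟩
    t′                      ∎
    where
    open ≡-Reasoning
    results≐ : result t ≐ invertAll (decode t′) (toList (sets t))
    results≐ = subst (λ Xs → result t ≐ invertAll (decode t′) (toList Xs)) (sym sets≡)
      (encode-injective (result-isTournament t) (result-isTournament t′) codes≡)

  codeCount≤ : codeCount n ≤ (2 ^ n) ^ s * length strongCodes
  codeCount≤ = card-≤ (Code↔Fin n) (Vec↔Fin (Subset↔Fin n) s) sets (λ t → Any.index (result∈ t))
    (λ t t′ sets≡ index≡ → determined sets≡ (index-injective (setoid (Code n)) (result∈ t) (result∈ t′) index≡))

  -- The injection bound is squared to match `length-nearRegular`; the square of the number of all
  -- codes then cancels.
  n!≤ : n ! ≤ (2 ^ n) ^ s * (2 ^ n) ^ s * (c * c) ^ n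
  n!≤ = *-cancelˡ-≤ (N * N) {{m*n≢0 N N}} (begin
    N * N * n !                         ≤⟨ *-monoˡ-≤ (n !) (*-mono-≤ codeCount≤ codeCount≤) ⟩
    (P * L) * (P * L) * n !             ≡⟨ regroup P L (n !) ⟩
    P * P * (L * L * n !)               ≤⟨ *-monoʳ-≤ (P * P) (length-nearRegular n (λ _ → 0)) ⟩
    P * P * ((c * c) ^ n * (N * N))     ≡⟨ regroup′ (P * P) ((c * c) ^ n) (N * N) ⟩
    N * N * (P * P * (c * c) ^ n)       ∎)
    where
    open ≤-Reasoning
    N = codeCount n
    L = length strongCodes
    P = (2 ^ n) ^ s
    instance
      N≢0 : NonZero N
      N≢0 = codeCount≢0 n
    regroup : ∀ p l f → (p * l) * (p * l) * f ≡ p * p * (l * l * f)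
    regroup = solve-∀
    regroup′ : ∀ p c m → p * (c * m) ≡ m * (p * c)
    regroup′ = solve-∀

  -- Swapping exponents makes every factor beside n! an n-th power, and 4 is absorbed into (2ˢ 2c)².
  -- If this square were at most n, then nⁿ < nⁿ would follow.
  n<[2^s*2c]² : n < (2 ^ s * (2 * c)) ^ 2
  n<[2^s*2c]² = ≰⇒> λ g²≤n → <-irrefl refl (begin-strict
    n ^ n                                                  <⟨ n^n<4^n*n! n (≤-trans (n≤1+n 1) 2≤n) ⟩
    4 ^ n * n !                                            ≤⟨ *-monoʳ-≤ (4 ^ n) n!≤ ⟩
    4 ^ n * ((2 ^ n) ^ s * (2 ^ n) ^ s * (c * c) ^ n)      ≡⟨ cong (λ p → 4 ^ n * (p * p * (c * c) ^ n)) [2^n]^s≡g^n ⟩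
    4 ^ n * (g ^ n * g ^ n * (c * c) ^ n)                  ≡⟨ cong (λ p → 4 ^ n * (p * (c * c) ^ n)) (^-distribʳ-* g g n) ⟨
    4 ^ n * ((g * g) ^ n * (c * c) ^ n)                    ≡⟨ cong (4 ^ n *_) (^-distribʳ-* (g * g) (c * c) n) ⟨
    4 ^ n * (g * g * (c * c)) ^ n                          ≡⟨ ^-distribʳ-* 4 (g * g * (c * c)) n ⟨
    (4 * (g * g * (c * c))) ^ n                            ≡⟨ cong (_^ n) (square g c) ⟩
    ((g * (2 * c)) ^ 2) ^ n                                ≤⟨ ^-monoˡ-≤ n g²≤n ⟩
    n ^ n                                                  ∎)
    where
    open ≤-Reasoning
    g = 2 ^ s
    [2^n]^s≡g^n : (2 ^ n) ^ s ≡ g ^ n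
    [2^n]^s≡g^n = trans (^-*-assoc 2 n s) (trans (cong (2 ^_) (*-comm n s)) (sym (^-*-assoc 2 s n)))
    square : ∀ g c → 4 * (g * g * (c * c)) ≡ (g * (2 * c)) * ((g * (2 * c)) * 1)
    square = solve-∀

-- Every tournament needs at most m sets, and padding turns this into exactly m, as the counting
-- requires.
m′-lower : ∀ {k c m} → 1 ≤ k → 1 ≤ c → M′ k (2 * k + c) m → m >½log (2 * k + c) -log (2 * c)
m′-lower {k} {c} {m} 1≤k 1≤c (_ , maximal) = Counting.n<[2^s*2c]² 2≤n invertible
  where
  2≤n : 2 ≤ 2 * k + c
  2≤n = ≤-trans (*-monoʳ-≤ 2 1≤k) (m≤m+n (2 * k) c)
  invertible : ∀ t → InvertibleIn k (decode t) m
  invertible t =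
    let s , sinv = sinv′-exists (+-monoʳ-≤ (2 * k) 1≤c) (decode-isTournament t)
    in  invertibleIn-mono (≤⇒≤′ (maximal s (decode t , decode-isTournament t , sinv))) (proj₁ sinv)

theorem5p7 : (∀ (c : ℕ) → 1 ≤ c →
    ∃[ K ] (∀ (k : ℕ) → 1 ≤ k → K ≤ k →
    Σ[ T ∈ Tournament (2 * k + c) ] ∃[ s ]
    (Sinv′ k (proj₁ T) s × s >½log (2 * k + c) -log (2 * c))))
    ×
    (∀ (c : ℕ) → 1 ≤ c →
    ∀ (B K : ℕ) →
    ∃[ k ] (1 ≤ k × K ≤ k × ∃[ m ] (M′ k (2 * k + c) m × B < m)))
theorem5p7 = lowerBound , unbounded
  where
  lowerBound : ∀ c → 1 ≤ c → _
  lowerBound c 1≤c = 0 , λ k 1≤k _ → attained k 1≤k (m′-exists (+-monoʳ-≤ (2 * k) 1≤c))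
    where
    attained : ∀ k → 1 ≤ k → ∃[ m ] M′ k (2 * k + c) m →
      Σ[ T ∈ Tournament (2 * k + c) ] ∃[ s ] (Sinv′ k (proj₁ T) s × s >½log (2 * k + c) -log (2 * c))
    attained k 1≤k (m , m′@((D , tour , sinv) , _)) = (D , tour) , m , sinv , m′-lower 1≤k 1≤c m′

  unbounded : ∀ c → 1 ≤ c → ∀ B K → ∃[ k ] (1 ≤ k × K ≤ k × ∃[ m ] (M′ k (2 * k + c) m × B < m))
  unbounded c 1≤c B K = k , s≤s z≤n , m≤n⇒m≤1+n (m≤m+n K q) , large (m′-exists (+-monoʳ-≤ (2 * k) 1≤c))
    where
    open ≤-Reasoning
    -- The upper bound on the order that m ≤ B would impose; `k` is chosen above both it and `K`.
    q = (2 ^ B * (2 * c)) ^ 2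
    k = suc (K + q)
    large : ∃[ m ] M′ k (2 * k + c) m → ∃[ m ] (M′ k (2 * k + c) m × B < m)
    large (m , m′) = m , m′ , ≰⇒> λ m≤B → <-irrefl refl (begin-strict
      q                               ≤⟨ m≤n⇒m≤1+n (m≤n+m q K) ⟩
      k                               ≤⟨ m≤m+n k (k + 0) ⟩
      2 * k                           ≤⟨ m≤m+n (2 * k) c ⟩
      2 * k + c                       <⟨ m′-lower (s≤s z≤n) 1≤c m′ ⟩
      (2 ^ m * (2 * c)) ^ 2           ≤⟨ ^-monoˡ-≤ 2 (*-monoˡ-≤ (2 * c) (^-monoʳ-≤ 2 m≤B)) ⟩
      q                               ∎)
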